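{- The logic $\mathsf{sCond}^{\mathbf{UC}}_{\mathrm{ACL}}:=\mathsf{ICK}\oplus(q\to(p>q))\oplus(p>((p>q)\to q))$ is sound and complete with respect to the class of conditional Kripke frames $(X,\le,\mathcal R)$ such that for all $x,y\in X$ and all upsets $a$: if $xR_ay$ then $x\le y$; and if there is $u$ with $xR_au$ and $u\le y$, then there is $v$ with $yR_av$ and $v\le y$.
   Context: Formulas: $\phi::=p\mid\bot\mid\phi\wedge\phi\mid\phi\vee\phi\mid\phi\to\phi\mid\phi>\phi$, $\top:=\bot\to\bot$. $\mathsf{ICK}\oplus\Gamma$ is the smallest set of formulas containing the axioms of intuitionistic propositional logic, $\Gamma$, $(p>(q\wedge r))\leftrightarrow((p>q)\wedge(p>r))$ and $(p>\top)\leftrightarrow\top$, closed under uniform substitution, modus ponens and: from $\phi\leftrightarrow\psi$ infer $(\phi>\chi)\leftrightarrow(\psi>\chi)$ and $(\chi>\phi)\leftrightarrow(\chi>\psi)$. A conditional Kripke frame is $(X,\le,\mathcal R)$, $(X,\le)$ a nonempty preorder, $\mathcal R=\{R_a: a\text{ upset}\}$ such that $x\le yR_az$ implies $xR_aw\le z$ for some $w$. Valuations map variables to upsets; intuitionistic Kripke clauses and $x\models\phi>\psi$ iff every $y$ with $xR_{V(\phi)}y$ satisfies $\psi$. Sound and complete: the logic's members are exactly the formulas valid on all frames in the class. -}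

module Defs where

open import Level using (Level; Lift; _⊔_; Setω) renaming (suc to lsuc; zero to lzero)
open import Data.Nat using (ℕ)
open import Data.Product using (Σ; _×_; _,_; proj₁; proj₂)
open import Data.Sum using (_⊎_; inj₁; inj₂)
open import Data.Empty using (⊥)

infixr 6 _∧'_
infixr 5 _∨'_
infixr 4 _⇒_
infixr 7 _▷_
infix 3 _⇔'_

data Fm : Set where
  var  : ℕ → Fm
  ⊥'   : Fm
  _∧'_ : Fm → Fm → Fm
  _∨'_ : Fm → Fm → Fm
  _⇒_  : Fm → Fm → Fm
  _▷_  : Fm → Fm → Fm

⊤' : Fm
⊤' = ⊥' ⇒ ⊥'

_⇔'_ : Fm → Fm → Fm
φ ⇔' ψ = (φ ⇒ ψ) ∧' (ψ ⇒ φ)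

sub : (ℕ → Fm) → Fm → Fm
sub σ (var n)  = σ n
sub σ ⊥'       = ⊥'
sub σ (φ ∧' ψ) = sub σ φ ∧' sub σ ψ
sub σ (φ ∨' ψ) = sub σ φ ∨' sub σ ψ
sub σ (φ ⇒ ψ)  = sub σ φ ⇒ sub σ ψ
sub σ (φ ▷ ψ)  = sub σ φ ▷ sub σ ψ

p q r : Fm
p = var 0
q = var 1
r = var 2

-- A standard Hilbert axiomatisation of intuitionistic propositional logic
-- (axioms as formulas in the variables p q r; closure under uniform
-- substitution yields all instances).
data IPCAxiom : Fm → Set where
  K     : IPCAxiom (p ⇒ (q ⇒ p))
  S     : IPCAxiom ((p ⇒ (q ⇒ r)) ⇒ ((p ⇒ q) ⇒ (p ⇒ r)))
  ∧E₁   : IPCAxiom ((p ∧' q) ⇒ p)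
  ∧E₂   : IPCAxiom ((p ∧' q) ⇒ q)
  ∧I    : IPCAxiom (p ⇒ (q ⇒ (p ∧' q)))
  ∨I₁   : IPCAxiom (p ⇒ (p ∨' q))
  ∨I₂   : IPCAxiom (q ⇒ (p ∨' q))
  ∨E    : IPCAxiom ((p ⇒ r) ⇒ ((q ⇒ r) ⇒ ((p ∨' q) ⇒ r)))
  efq   : IPCAxiom (⊥' ⇒ p)

data ICK⊕ (Γ : Fm → Set) : Fm → Set where
  ipc   : ∀ {φ} → IPCAxiom φ → ICK⊕ Γ φ
  extra : ∀ {φ} → Γ φ → ICK⊕ Γ φ
  ck∧   : ICK⊕ Γ ((p ▷ (q ∧' r)) ⇔' ((p ▷ q) ∧' (p ▷ r)))
  ck⊤   : ICK⊕ Γ ((p ▷ ⊤') ⇔' ⊤')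
  usub  : ∀ {φ} (σ : ℕ → Fm) → ICK⊕ Γ φ → ICK⊕ Γ (sub σ φ)
  mp    : ∀ {φ ψ} → ICK⊕ Γ (φ ⇒ ψ) → ICK⊕ Γ φ → ICK⊕ Γ ψ
  congˡ : ∀ {φ ψ} (χ : Fm) → ICK⊕ Γ (φ ⇔' ψ) → ICK⊕ Γ ((φ ▷ χ) ⇔' (ψ ▷ χ))
  congʳ : ∀ {φ ψ} (χ : Fm) → ICK⊕ Γ (φ ⇔' ψ) → ICK⊕ Γ ((χ ▷ φ) ⇔' (χ ▷ ψ))

data ACL-UC : Fm → Set where
  ax₁ : ACL-UC (q ⇒ (p ▷ q))
  ax₂ : ACL-UC (p ▷ ((p ▷ q) ⇒ q))

sCondUC-ACL : Fm → Set
sCondUC-ACL = ICK⊕ ACL-UC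

record UpsetOf {ℓ : Level} (X : Set ℓ) (_≤_ : X → X → Set ℓ) : Set (lsuc ℓ) where
  field
    mem : X → Set ℓ
    up  : ∀ {x y} → x ≤ y → mem x → mem y
open UpsetOf public

record Frame (ℓ : Level) : Set (lsuc ℓ) where
  field
    X      : Set ℓ
    _≤_    : X → X → Set ℓ
    ≤-refl : ∀ {x} → x ≤ x
    ≤-trans : ∀ {x y z} → x ≤ y → y ≤ z → x ≤ z
    point  : X                                   -- nonempty
    R      : UpsetOf X _≤_ → X → X → Set ℓ
    -- upsets are sets: R_a depends only on the extension of a
    R-ext  : ∀ (a b : UpsetOf X _≤_) → (∀ x → (mem a x → mem b x) × (mem b x → mem a x))
             → ∀ {x y} → R a x y → R b x y
    frameCond : ∀ (a : UpsetOf X _≤_) {x y z} → x ≤ y → R a y z → Σ X (λ w → R a x w × (w ≤ z))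



Upset : ∀ {ℓ} → Frame ℓ → Set (lsuc ℓ)
Upset F = UpsetOf (Frame.X F) (Frame._≤_ F)

record InClass {ℓ : Level} (F : Frame ℓ) : Set (lsuc ℓ) where
  open Frame F
  field
    R⊆≤  : ∀ (a : UpsetOf X _≤_) {x y} → R a x y → x ≤ y
    cond : ∀ (a : UpsetOf X _≤_) {x y} → Σ X (λ u → R a x u × (u ≤ y))
           → Σ X (λ v → R a y v × (v ≤ y))

module Sem {ℓ : Level} (F : Frame ℓ) (V : ℕ → Upset F) where
  open Frame F

  mutual
    _⊨_ : X → Fm → Set ℓ
    x ⊨ var n    = mem (V n) x
    x ⊨ ⊥'       = Lift ℓ ⊥
    x ⊨ (φ ∧' ψ) = (x ⊨ φ) × (x ⊨ ψ)
    x ⊨ (φ ∨' ψ) = (x ⊨ φ) ⊎ (x ⊨ ψ)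
    x ⊨ (φ ⇒ ψ)  = ∀ y → x ≤ y → y ⊨ φ → y ⊨ ψ
    x ⊨ (φ ▷ ψ)  = ∀ y → R (⟦ φ ⟧) x y → y ⊨ ψ

    ⟦_⟧ : Fm → Upset F
    ⟦ φ ⟧ = record { mem = λ x → x ⊨ φ ; up = persist φ }

    persist : ∀ φ {x y} → x ≤ y → x ⊨ φ → y ⊨ φ
    persist (var n)  x≤y h = up (V n) x≤y h
    persist ⊥'       x≤y h = h
    persist (φ ∧' ψ) x≤y (a , b) = persist φ x≤y a , persist ψ x≤y b
    persist (φ ∨' ψ) x≤y (inj₁ a) = inj₁ (persist φ x≤y a)
    persist (φ ∨' ψ) x≤y (inj₂ b) = inj₂ (persist ψ x≤y b)
    persist (φ ⇒ ψ)  x≤y h z y≤z = h z (≤-trans x≤y y≤z)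
    persist (φ ▷ ψ)  x≤y h z yRz with frameCond ⟦ φ ⟧ x≤y yRz
    ... | w , xRw , w≤z = persist ψ w≤z (h w xRw)

Valid : (ℓ : Level) → Fm → Set (lsuc ℓ)
Valid ℓ φ = (F : Frame ℓ) → InClass F → (V : ℕ → Upset F) → (x : Frame.X F)
            → Sem._⊨_ F V x φ

record _∧ω_ (A B : Setω) : Setω where
  constructor _,ω_
  field
    fstω : A
    sndω : B

{-# OPTIONS --safe #-}

-- Write s_φ for the conjunction of (φ ▷ ψ) ⇒ ψ over all ψ in a finite set Sf.
-- The two extra axioms say exactly that φ ▷ ψ is equivalent to s_φ ⇒ ψ for ψ
-- in Sf, so ▷ behaves like an intuitionistic implication whose antecedent
-- depends congruentially on φ.  Semantically, on a frame of the class R_a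
-- amounts, up to the equivalence induced by ≤, to an arbitrary upset S_a, with
-- R_a x y meaning x ≤ y and y ∈ S_a.
--
-- Completeness is constructive.  The candidate worlds are the two-block
-- partitions of the finite set of subformulas φ of the goal and their s_φ.
-- Worlds whose positive block provably entails the disjunction of the negative
-- one are thrown away until no defect (a missing witness for ⇒ or ▷, or two
-- coextensive φ, φ′ with different s_φ, s_φ′) is left: every defect makes some
-- surviving world inconsistent.  The survivors form a finite model.
module Submission where

open import Defs
open import Level using (Level; lift; lower) renaming (zero to lzero)
open import Data.Nat using (ℕ; zero; suc; _≤_; s≤s) renaming (_≟_ to _≟ℕ_)
open import Data.Nat.Properties using (≤-refl)
open import Data.Bool using (Bool; true; false)
open import Data.Product as Product using (Σ; ∃; _×_; _,_; proj₁; proj₂)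
open import Data.Sum as Sum using (_⊎_; inj₁; inj₂; [_,_]′)
open import Data.Empty using (⊥; ⊥-elim)
open import Data.Unit using (⊤; tt)
open import Data.List using (List; []; _∷_; _++_; map; foldr; length)
open import Data.List.Properties using (length-removeAt′)
open import Data.List.Relation.Unary.All using (All; []; _∷_)
open import Data.List.Relation.Unary.Any using (here; there; _─_; index)
open import Data.List.Membership.Propositional using (_∈_)
open import Data.List.Membership.Propositional.Properties using (∈-++⁺ˡ; ∈-++⁺ʳ; ∈-map⁺)
open import Function using (_∘_; id)
open import Relation.Nullary using (Dec; yes; no; ¬_)
open import Relation.Nullary.Decidable using (map′; _×-dec_; _⊎-dec_; toSum)
open import Relation.Binary.PropositionalEquality using (_≡_; refl; subst; cong; cong₂)

-- Decidable equality of formulas.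

_≟_ : (φ ψ : Fm) → Dec (φ ≡ ψ)
var m ≟ var n = map′ (cong var) (λ { refl → refl }) (m ≟ℕ n)
(var _) ≟ ⊥' = no λ ()
(var _) ≟ (_ ∧' _) = no λ ()
(var _) ≟ (_ ∨' _) = no λ ()
(var _) ≟ (_ ⇒ _) = no λ ()
(var _) ≟ (_ ▷ _) = no λ ()
⊥' ≟ (var _) = no λ ()
⊥' ≟ ⊥' = yes refl
⊥' ≟ (_ ∧' _) = no λ ()
⊥' ≟ (_ ∨' _) = no λ ()
⊥' ≟ (_ ⇒ _) = no λ ()
⊥' ≟ (_ ▷ _) = no λ ()
(_ ∧' _) ≟ (var _) = no λ ()
(_ ∧' _) ≟ ⊥' = no λ ()
(a ∧' b) ≟ (c ∧' d) = map′ (λ (e , f) → cong₂ _∧'_ e f) (λ { refl → refl , refl }) (a ≟ c ×-dec b ≟ d)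
(_ ∧' _) ≟ (_ ∨' _) = no λ ()
(_ ∧' _) ≟ (_ ⇒ _) = no λ ()
(_ ∧' _) ≟ (_ ▷ _) = no λ ()
(_ ∨' _) ≟ (var _) = no λ ()
(_ ∨' _) ≟ ⊥' = no λ ()
(_ ∨' _) ≟ (_ ∧' _) = no λ ()
(a ∨' b) ≟ (c ∨' d) = map′ (λ (e , f) → cong₂ _∨'_ e f) (λ { refl → refl , refl }) (a ≟ c ×-dec b ≟ d)
(_ ∨' _) ≟ (_ ⇒ _) = no λ ()
(_ ∨' _) ≟ (_ ▷ _) = no λ ()
(_ ⇒ _) ≟ (var _) = no λ ()
(_ ⇒ _) ≟ ⊥' = no λ ()
(_ ⇒ _) ≟ (_ ∧' _) = no λ ()
(_ ⇒ _) ≟ (_ ∨' _) = no λ ()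
(a ⇒ b) ≟ (c ⇒ d) = map′ (λ (e , f) → cong₂ _⇒_ e f) (λ { refl → refl , refl }) (a ≟ c ×-dec b ≟ d)
(_ ⇒ _) ≟ (_ ▷ _) = no λ ()
(_ ▷ _) ≟ (var _) = no λ ()
(_ ▷ _) ≟ ⊥' = no λ ()
(_ ▷ _) ≟ (_ ∧' _) = no λ ()
(_ ▷ _) ≟ (_ ∨' _) = no λ ()
(_ ▷ _) ≟ (_ ⇒ _) = no λ ()
(a ▷ b) ≟ (c ▷ d) = map′ (λ (e , f) → cong₂ _▷_ e f) (λ { refl → refl , refl }) (a ≟ c ×-dec b ≟ d)

open import Data.List.Membership.DecPropositional _≟_ using (_∈?_)

-- Intuitionistic reasoning

⟨_,_,_⟩ : Fm → Fm → Fm → ℕ → Fm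
⟨ a , b , c ⟩ zero          = a
⟨ a , b , c ⟩ (suc zero)    = b
⟨ a , b , c ⟩ (suc (suc _)) = c

module Derivations {Ax : Fm → Set} where

  infix 2 _⊢_
  _⊢_ : Fm → Fm → Set
  a ⊢ b = ICK⊕ Ax (a ⇒ b)

  instanceOf : ∀ {φ} → IPCAxiom φ → ∀ a b c → ICK⊕ Ax (sub ⟨ a , b , c ⟩ φ)
  instanceOf ax a b c = usub ⟨ a , b , c ⟩ (ipc ax)

  weaken : ∀ {a b} → ICK⊕ Ax b → a ⊢ b
  weaken {a} {b} = mp (instanceOf K b a a)

  ⊢-apply : ∀ {a b c} → a ⊢ b ⇒ c → a ⊢ b → a ⊢ c
  ⊢-apply {a} {b} {c} f = mp (mp (instanceOf S a b c) f)

  ⊢-refl : ∀ {a} → a ⊢ a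
  ⊢-refl {a} = ⊢-apply (instanceOf K a (a ⇒ a) a) (instanceOf K a a a)

  ⊢-trans : ∀ {a b c} → a ⊢ b → b ⊢ c → a ⊢ c
  ⊢-trans f g = ⊢-apply (weaken g) f

  fst : ∀ {a b} → a ∧' b ⊢ a
  fst {a} {b} = instanceOf ∧E₁ a b a

  snd : ∀ {a b} → a ∧' b ⊢ b
  snd {a} {b} = instanceOf ∧E₂ a b a

  pair : ∀ {a b c} → a ⊢ b → a ⊢ c → a ⊢ b ∧' c
  pair {a} {b} {c} f = ⊢-apply (⊢-trans f (instanceOf ∧I b c a))

  curry : ∀ {a b c} → a ∧' b ⊢ c → a ⊢ b ⇒ c
  curry {a} {b} {c} f =
    ⊢-trans (instanceOf ∧I a b a) (mp (instanceOf S b (a ∧' b) c) (weaken f))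

  uncurry : ∀ {a b c} → a ⊢ b ⇒ c → a ∧' b ⊢ c
  uncurry f = ⊢-apply (⊢-trans fst f) snd

  swap : ∀ {a b} → a ∧' b ⊢ b ∧' a
  swap = pair snd fst

  ∧-assoc : ∀ {a b c} → (a ∧' b) ∧' c ⊢ a ∧' (b ∧' c)
  ∧-assoc = pair (⊢-trans fst fst) (pair (⊢-trans fst snd) snd)

  inl : ∀ {a b} → a ⊢ a ∨' b
  inl {a} {b} = instanceOf ∨I₁ a b a

  inr : ∀ {a b} → b ⊢ a ∨' b
  inr {a} {b} = instanceOf ∨I₂ a b a

  cases : ∀ {a b c} → a ⊢ c → b ⊢ c → a ∨' b ⊢ c
  cases {a} {b} {c} f g = mp (mp (instanceOf ∨E a b c) f) g

  ∨-assoc : ∀ {a b c} → a ∨' (b ∨' c) ⊢ (a ∨' b) ∨' c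
  ∨-assoc = cases (⊢-trans inl inl) (cases (⊢-trans inr inl) inr)

  absurd : ∀ {a} → ⊥' ⊢ a
  absurd {a} = instanceOf efq a a a

  ⊤-intro : ∀ {a} → a ⊢ ⊤'
  ⊤-intro = weaken ⊢-refl

  -- Both disjuncts of b ∨' c yield a ⇒ b, which is then applied to a itself; this avoids
  -- distributing a over the disjunction.
  cut : ∀ {a b c} → a ∧' c ⊢ b → a ⊢ b ∨' c → a ⊢ b
  cut f g = ⊢-apply (⊢-trans g (cases (curry fst) (curry (⊢-trans swap f)))) ⊢-refl

  iff : ∀ {a b} → a ⊢ b → b ⊢ a → ICK⊕ Ax (a ⇔' b)
  iff f g = mp (mp (instanceOf ∧I _ _ ⊥') f) g

  forth : ∀ {a b} → ICK⊕ Ax (a ⇔' b) → a ⊢ b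
  forth = mp fst

  ⋀ ⋁ : List Fm → Fm
  ⋀ = foldr _∧'_ ⊤'
  ⋁ = foldr _∨'_ ⊥'

  ⋀-lower : ∀ {a as} → a ∈ as → ⋀ as ⊢ a
  ⋀-lower (here refl) = fst
  ⋀-lower (there i)   = ⊢-trans snd (⋀-lower i)

  ⋁-upper : ∀ {a as} → a ∈ as → a ⊢ ⋁ as
  ⋁-upper (here refl) = inl
  ⋁-upper (there i)   = ⊢-trans (⋁-upper i) inr

  ▷-∧ : ∀ {a b c} → (a ▷ b) ∧' (a ▷ c) ⊢ a ▷ (b ∧' c)
  ▷-∧ {a} {b} {c} = mp snd (usub ⟨ a , b , c ⟩ ck∧)

  -- If b entails c, then b is equivalent to b ∧' c, so `congʳ` and `ck∧` apply.
  ▷-monoʳ : ∀ {a b c} → b ⊢ c → a ▷ b ⊢ a ▷ c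
  ▷-monoʳ {a} {b} {c} f =
    ⊢-trans (forth (congʳ a (iff (pair ⊢-refl f) fst)))
            (⊢-trans (forth (usub ⟨ a , b , c ⟩ ck∧)) snd)

  ▷-congˡ : ∀ {a b c} → a ⊢ b → b ⊢ a → a ▷ c ⊢ b ▷ c
  ▷-congˡ f g = forth (congˡ _ (iff f g))

open Derivations {ACL-UC}

-- The antecedent s_φ

▷-intro : ∀ {a b} → b ⊢ a ▷ b
▷-intro {a} {b} = usub ⟨ a , b , a ⟩ (extra ax₁)

s : List Fm → Fm → Fm
s Sf φ = ⋀ (map (λ ψ → (φ ▷ ψ) ⇒ ψ) Sf)

s-elim : ∀ {Sf φ ψ} → ψ ∈ Sf → (φ ▷ ψ) ∧' s Sf φ ⊢ ψ
s-elim ψ∈ = ⊢-trans swap (uncurry (⋀-lower (∈-map⁺ _ ψ∈)))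

-- Each conjunct under φ ▷ is an instance of `ax₂`, and `▷-∧` collects them.
▷-s : ∀ Sf φ → sCondUC-ACL (φ ▷ s Sf φ)
▷-s []       φ = mp ▷-intro ⊢-refl
▷-s (ψ ∷ Sf) φ =
  mp ▷-∧ (mp (pair (weaken (usub ⟨ φ , ψ , φ ⟩ (extra ax₂))) ⊢-refl) (▷-s Sf φ))

-- By `ax₁` the implication moves under φ ▷; there it meets s Sf φ, supplied by `▷-s`, and modus
-- ponens takes place inside the consequent.
s-intro : ∀ {Sf φ ψ} → s Sf φ ⇒ ψ ⊢ φ ▷ ψ
s-intro {Sf} {φ} =
  ⊢-trans (pair ▷-intro (weaken (▷-s Sf φ))) (⊢-trans ▷-∧ (▷-monoʳ (uncurry ⊢-refl)))

-- In each conjunct φ ▷ ψ stands to the left of an arrow, so the congruence is applied from φ′ back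
-- to φ.
s-cong : ∀ {Sf φ φ′} → φ ⊢ φ′ → φ′ ⊢ φ → s Sf φ ⊢ s Sf φ′
s-cong {[]}     f g = ⊢-refl
s-cong {ψ ∷ Sf} f g =
  pair (curry (⊢-apply (⊢-trans fst fst) (⊢-trans snd (▷-congˡ g f))))
       (⊢-trans snd (s-cong {Sf} f g))

-- Soundness

module Soundness {ℓ : Level} {F : Frame ℓ} where
  open Frame F renaming (≤-refl to ≼-refl; ≤-trans to ≼-trans; _≤_ to _≼_)

  -- Both directions are proved together because of the antecedents. For ▷ the two truth sets agree
  -- only pointwise, and `R-ext` carries the relation across.
  ⊨-sub : (V : ℕ → Upset F) (σ : ℕ → Fm) → ∀ φ x →
          let module M = Sem F V
              module N = Sem F (λ n → M.⟦ σ n ⟧)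
          in (x N.⊨ φ → x M.⊨ sub σ φ) × (x M.⊨ sub σ φ → x N.⊨ φ)
  ⊨-sub V σ (var n) x = id , id
  ⊨-sub V σ ⊥' x = id , id
  ⊨-sub V σ (φ ∧' ψ) x =
    (λ (h , k) → proj₁ (⊨-sub V σ φ x) h , proj₁ (⊨-sub V σ ψ x) k) ,
    (λ (h , k) → proj₂ (⊨-sub V σ φ x) h , proj₂ (⊨-sub V σ ψ x) k)
  ⊨-sub V σ (φ ∨' ψ) x =
    Sum.map (proj₁ (⊨-sub V σ φ x)) (proj₁ (⊨-sub V σ ψ x)) ,
    Sum.map (proj₂ (⊨-sub V σ φ x)) (proj₂ (⊨-sub V σ ψ x))
  ⊨-sub V σ (φ ⇒ ψ) x =
    (λ h y x≼y k → proj₁ (⊨-sub V σ ψ y) (h y x≼y (proj₂ (⊨-sub V σ φ y) k))) ,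
    (λ h y x≼y k → proj₂ (⊨-sub V σ ψ y) (h y x≼y (proj₁ (⊨-sub V σ φ y) k)))
  ⊨-sub V σ (φ ▷ ψ) x =
    (λ h y xRy → proj₁ (⊨-sub V σ ψ y) (h y (R-ext _ _ (Product.swap ∘ ⊨-sub V σ φ) xRy))) ,
    (λ h y xRy → proj₂ (⊨-sub V σ ψ y) (h y (R-ext _ _ (⊨-sub V σ φ) xRy)))

  module _ (inClass : InClass F) where
    open InClass inClass

    ipc-sound : ∀ {φ} → IPCAxiom φ → (V : ℕ → Upset F) → ∀ x → Sem._⊨_ F V x φ
    ipc-sound K V x y x≼y a z y≼z b = up (V 0) y≼z a
    ipc-sound S V x y x≼y f z y≼z g u z≼u a =
      f u (≼-trans y≼z z≼u) a u ≼-refl (g u z≼u a)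
    ipc-sound ∧E₁ V x y x≼y (a , b) = a
    ipc-sound ∧E₂ V x y x≼y (a , b) = b
    ipc-sound ∧I V x y x≼y a z y≼z b = up (V 0) y≼z a , b
    ipc-sound ∨I₁ V x y x≼y a = inj₁ a
    ipc-sound ∨I₂ V x y x≼y b = inj₂ b
    ipc-sound ∨E V x y x≼y f z y≼z g u z≼u (inj₁ a) = f u (≼-trans y≼z z≼u) a
    ipc-sound ∨E V x y x≼y f z y≼z g u z≼u (inj₂ b) = g u z≼u b
    ipc-sound efq V x y x≼y e = ⊥-elim (lower e)

    sound : ∀ {φ} → sCondUC-ACL φ → (V : ℕ → Upset F) → ∀ x → Sem._⊨_ F V x φ

    coextensive : ∀ {φ ψ} → sCondUC-ACL (φ ⇔' ψ) → (V : ℕ → Upset F) → let open Sem F V in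
                  ∀ x → (x ⊨ φ → x ⊨ ψ) × (x ⊨ ψ → x ⊨ φ)
    coextensive d V x = proj₁ (sound d V x) x ≼-refl , proj₂ (sound d V x) x ≼-refl

    sound (ipc ax) V x = ipc-sound ax V x
    sound (extra ax₁) V x y x≼y b z yRz = up (V 1) (R⊆≤ _ yRz) b
    -- The successor y of x lies below z, so `cond` gives z a successor v below z; h puts q at v,
    -- and q persists up to z.
    sound (extra ax₂) V x y xRy z y≼z h with cond _ (y , xRy , y≼z)
    ... | v , zRv , v≼z = up (V 1) v≼z (h v zRv)
    sound ck∧ V x =
      (λ y x≼y h → (λ z yRz → proj₁ (h z yRz)) , (λ z yRz → proj₂ (h z yRz))) ,
      (λ y x≼y (h , k) z yRz → h z yRz , k z yRz)
    sound ck⊤ V x = (λ y x≼y h z y≼z e → e) , (λ y x≼y h z yRz u z≼u e → e)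
    sound (usub {φ} σ d) V x = proj₁ (⊨-sub V σ φ x) (sound d _ x)
    sound (mp d e) V x = sound d V x x ≼-refl (sound e V x)
    sound (congˡ χ d) V x =
      (λ y x≼y h z yRz → h z (R-ext _ _ (Product.swap ∘ coextensive d V) yRz)) ,
      (λ y x≼y h z yRz → h z (R-ext _ _ (coextensive d V) yRz))
    sound (congʳ χ d) V x =
      (λ y x≼y h z yRz → proj₁ (coextensive d V z) (h z yRz)) ,
      (λ y x≼y h z yRz → proj₂ (coextensive d V z) (h z yRz))

-- Worlds as two-block partitions

-- One label per list entry: a formula occurring twice in Θ may get both labels, which is why
-- disjointness of the blocks is checked separately.
World : List Fm → Set
World Θ = All (λ _ → Bool) Θ

pos neg : ∀ {Θ} → World Θ → List Fm
pos []                  = []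
pos {χ ∷ _} (true ∷ w)  = χ ∷ pos w
pos {χ ∷ _} (false ∷ w) = pos w
neg []                  = []
neg {χ ∷ _} (true ∷ w)  = neg w
neg {χ ∷ _} (false ∷ w) = χ ∷ neg w

pos⊎neg : ∀ {Θ χ} (w : World Θ) → χ ∈ Θ → χ ∈ pos w ⊎ χ ∈ neg w
pos⊎neg (true ∷ w)  (here e)  = inj₁ (here e)
pos⊎neg (false ∷ w) (here e)  = inj₂ (here e)
pos⊎neg (true ∷ w)  (there i) = Sum.map₁ there (pos⊎neg w i)
pos⊎neg (false ∷ w) (there i) = Sum.map₂ there (pos⊎neg w i)

pos⊆ : ∀ {Θ χ} (w : World Θ) → χ ∈ pos w → χ ∈ Θ
pos⊆ (true ∷ w)  (here e)  = here e
pos⊆ (true ∷ w)  (there i) = there (pos⊆ w i)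
pos⊆ (false ∷ w) i         = there (pos⊆ w i)

worlds : ∀ Θ → List (World Θ)
worlds []      = [] ∷ []
worlds (_ ∷ Θ) = map (true ∷_) (worlds Θ) ++ map (false ∷_) (worlds Θ)

∈-worlds : ∀ {Θ} (w : World Θ) → w ∈ worlds Θ
∈-worlds []          = here refl
∈-worlds (true ∷ w)  = ∈-++⁺ˡ (∈-map⁺ (true ∷_) (∈-worlds w))
∈-worlds {_ ∷ Θ} (false ∷ w) =
  ∈-++⁺ʳ (map (true ∷_) (worlds Θ)) (∈-map⁺ (false ∷_) (∈-worlds w))

-- One `cut` per entry of Θ: χ becomes either an extra hypothesis or an extra alternative in the
-- conclusion.
split-on-worlds : ∀ {Θ a b} → (∀ (w : World Θ) → a ∧' ⋀ (pos w) ⊢ b ∨' ⋁ (neg w)) → a ⊢ b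
split-on-worlds {[]} f = ⊢-trans (pair ⊢-refl ⊤-intro) (⊢-trans (f []) (cases ⊢-refl absurd))
split-on-worlds {χ ∷ Θ} f =
  cut (split-on-worlds (λ w → ⊢-trans ∧-assoc (f (true ∷ w))))
      (split-on-worlds (λ w → ⊢-trans (f (false ∷ w)) ∨-assoc))

-- Elimination of inconsistent worlds

proper-subformulas subformulas : Fm → List Fm
subformulas φ = φ ∷ proper-subformulas φ
proper-subformulas (var n)  = []
proper-subformulas ⊥'       = []
proper-subformulas (φ ∧' ψ) = subformulas φ ++ subformulas ψ
proper-subformulas (φ ∨' ψ) = subformulas φ ++ subformulas ψ
proper-subformulas (φ ⇒ ψ)  = subformulas φ ++ subformulas ψ
proper-subformulas (φ ▷ ψ)  = subformulas φ ++ subformulas ψ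

infixr 1 _⊗_
-- In this and the next two combinators the left summand is an early exit, such as a derivation of
-- inconsistency, and the right one the outcome of a completed check.
_⊗_ : {A B C : Set} → A ⊎ B → A ⊎ C → A ⊎ (B × C)
inj₁ a ⊗ _      = inj₁ a
inj₂ b ⊗ inj₁ a = inj₁ a
inj₂ b ⊗ inj₂ c = inj₂ (b , c)

assuming : {A P Q : Set} → Dec P → (P → A ⊎ Q) → A ⊎ (P → Q)
assuming (yes x) f = Sum.map₂ (λ y _ → y) (f x)
assuming (no ¬x) f = inj₂ (⊥-elim ∘ ¬x)

search : {A B : Set} {Q : B → Set} (xs : List B) →
         (∀ {x} → x ∈ xs → A ⊎ Q x) → A ⊎ (∀ {x} → x ∈ xs → Q x)
search []       f = inj₂ λ ()
search (x ∷ xs) f with f (here refl) | search xs (f ∘ there)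
... | inj₁ a  | _      = inj₁ a
... | inj₂ _  | inj₁ a = inj₁ a
... | inj₂ qx | inj₂ g = inj₂ λ { (here refl) → qx ; (there i) → g i }

∈-─ : {A : Set} {x y : A} {xs : List A} (i : x ∈ xs) → y ∈ xs → y ≡ x ⊎ y ∈ (xs ─ i)
∈-─ (here refl) (here e)  = inj₁ e
∈-─ (here refl) (there j) = inj₂ j
∈-─ (there i)   (here e)  = inj₂ (here e)
∈-─ (there i)   (there j) = Sum.map₂ there (∈-─ i j)

module Elimination (φ₀ : Fm) where

  -- The s Sf φ are labelled as they stand, without adding their own subformulas: the truth lemma
  -- only evaluates members of `Sf`.
  Sf Θ : List Fm
  Sf = subformulas φ₀
  Θ  = Sf ++ map (s Sf) Sf

  Sf∈Θ : ∀ {φ} → φ ∈ Sf → φ ∈ Θ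
  Sf∈Θ = ∈-++⁺ˡ

  s∈Θ : ∀ {φ} → φ ∈ Sf → s Sf φ ∈ Θ
  s∈Θ i = ∈-++⁺ʳ Sf (∈-map⁺ (s Sf) i)

  _⊑_ : World Θ → World Θ → Set
  w ⊑ v = ∀ χ → χ ∈ pos w → χ ∈ pos v

  Inconsistent : World Θ → Set
  Inconsistent w = ⋀ (pos w) ⊢ ⋁ (neg w)

  module _ (L : List (World Θ)) where

    -- The invariant of the elimination: a world may leave L only with a proof of its inconsistency.
    Exhaustive : Set
    Exhaustive = ∀ w → Inconsistent w ⊎ w ∈ L

    -- θ behaves at w as α ⇒ ψ. For ⇒ the antecedent α is the actual one; for φ ▷ ψ it is s Sf φ.
    ActsAsArrow : Fm → Fm → Fm → World Θ → Set
    ActsAsArrow θ α ψ w =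
      (θ ∈ pos w → α ∈ pos w → ψ ∈ pos w) ×
      (θ ∈ pos w ⊎ ∃ λ v → v ∈ L × w ⊑ v × α ∈ pos v × ψ ∈ neg v)

    Saturated : Fm → World Θ → Set
    Saturated (var n) w = ⊤
    Saturated ⊥' w = ¬ ⊥' ∈ pos w
    Saturated (φ ∧' ψ) w =
      ((φ ∧' ψ ∈ pos w → φ ∈ pos w × ψ ∈ pos w) ×
       (φ ∈ pos w × ψ ∈ pos w → φ ∧' ψ ∈ pos w)) ×
      Saturated φ w × Saturated ψ w
    Saturated (φ ∨' ψ) w =
      ((φ ∨' ψ ∈ pos w → φ ∈ pos w ⊎ ψ ∈ pos w) ×
       (φ ∈ pos w ⊎ ψ ∈ pos w → φ ∨' ψ ∈ pos w)) ×
      Saturated φ w × Saturated ψ w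
    Saturated (φ ⇒ ψ) w = ActsAsArrow (φ ⇒ ψ) φ ψ w × Saturated φ w × Saturated ψ w
    Saturated (φ ▷ ψ) w = ActsAsArrow (φ ▷ ψ) (s Sf φ) ψ w × Saturated φ w × Saturated ψ w

    Entails : Fm → Fm → Set
    Entails φ ψ = ∀ {v} → v ∈ L → φ ∈ pos v → ψ ∈ pos v

    record Good (w : World Θ) : Set where
      field
        disjoint  : ∀ {χ} → χ ∈ pos w → χ ∈ neg w → ⊥
        congruent : ∀ {φ} → φ ∈ Sf → ∀ {ψ} → ψ ∈ Sf →
                    Entails φ ψ → Entails ψ φ → s Sf φ ∈ pos w → s Sf ψ ∈ pos w
        saturated : Saturated φ₀ w

  module _ {L : List (World Θ)} (exh : Exhaustive L) where

    -- Worlds outside L are inconsistent, so their sequents are derivable anyway.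
    split-on-L : ∀ {a b} → (∀ {v} → v ∈ L → a ∧' ⋀ (pos v) ⊢ b ∨' ⋁ (neg v)) → a ⊢ b
    split-on-L f = split-on-worlds λ v → [ (λ i → ⊢-trans snd (⊢-trans i inr)) , f ]′ (exh v)

    -- If no world of L is a counterexample, the sequent of every world of L is derivable, and
    -- splitting on L turns entailment in L into provability.
    entails? : ∀ {φ ψ} → φ ∈ Sf → ¬ Entails L φ ψ ⊎ φ ⊢ ψ
    entails? {φ} {ψ} φ∈ =
      Sum.map₂ (λ f → split-on-L λ {v} v∈L → sequent v (f v∈L) (pos⊎neg v (Sf∈Θ φ∈)))
      (search L λ {v} v∈L → assuming (φ ∈? pos v) λ i →
        [ inj₂ , (λ ¬j → inj₁ λ f → ¬j (f v∈L i)) ]′ (toSum (ψ ∈? pos v)))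
      where
      sequent : ∀ v → (φ ∈ pos v → ψ ∈ pos v) → φ ∈ pos v ⊎ φ ∈ neg v →
                φ ∧' ⋀ (pos v) ⊢ ψ ∨' ⋁ (neg v)
      sequent v f (inj₁ i) = ⊢-trans snd (⊢-trans (⋀-lower (f i)) inl)
      sequent v f (inj₂ i) = ⊢-trans fst (⊢-trans (⋁-upper i) inr)

    module _ (w : World Θ) where

      infer : ∀ {χ} → χ ∈ Θ → ⋀ (pos w) ⊢ χ → Inconsistent w ⊎ χ ∈ pos w
      infer χ∈ d = Sum.swap (Sum.map₂ (λ χ∈neg → ⊢-trans d (⋁-upper χ∈neg)) (pos⊎neg w χ∈))

      -- A world v of L that fails to be a witness makes its sequent derivable; if all fail,
      -- splitting on L derives ψ from w and α.
      find-arrow-witness : ∀ {α ψ} → α ∈ Θ → ψ ∈ Θ →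
        (∃ λ v → v ∈ L × w ⊑ v × α ∈ pos v × ψ ∈ neg v) ⊎ (⋀ (pos w) ⊢ α ⇒ ψ)
      find-arrow-witness {α} {ψ} α∈ ψ∈ = Sum.map₂ conclude (search L try)
        where
        Sequent : World Θ → Set
        Sequent v = (⋀ (pos w) ∧' α) ∧' ⋀ (pos v) ⊢ ψ ∨' ⋁ (neg v)

        conclude : (∀ {v} → v ∈ L → Sequent v) → ⋀ (pos w) ⊢ α ⇒ ψ
        conclude f = curry (split-on-L f)

        require : ∀ v {χ} → ⋀ (pos w) ∧' α ⊢ χ → χ ∈ pos v ⊎ χ ∈ neg v → Sequent v ⊎ χ ∈ pos v
        require v d (inj₁ i) = inj₂ i
        require v d (inj₂ i) = inj₁ (⊢-trans fst (⊢-trans d (⊢-trans (⋁-upper i) inr)))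

        try : ∀ {v} → v ∈ L →
              (∃ λ v → v ∈ L × w ⊑ v × α ∈ pos v × ψ ∈ neg v) ⊎ Sequent v
        -- The three requirements exit with the sequent of v, while the outer search exits with a
        -- witness; hence the swap.
        try {v} v∈L = Sum.swap (Sum.map₂ (λ h → v , v∈L , h)
          (Sum.map₂ (λ (f : ∀ {χ} → χ ∈ pos w → χ ∈ pos v) χ → f)
             (search (pos w) λ i → require v (⊢-trans fst (⋀-lower i)) (pos⊎neg v (pos⊆ w i)))
           ⊗ require v snd (pos⊎neg v α∈)
           ⊗ Sum.map₁ (λ i → ⊢-trans snd (⊢-trans (⋀-lower i) inl)) (pos⊎neg v ψ∈)))

      check-arrow : ∀ {θ α ψ} → θ ∈ Θ → α ∈ Θ → ψ ∈ Θ → θ ∧' α ⊢ ψ → α ⇒ ψ ⊢ θ →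
                    Inconsistent w ⊎ ActsAsArrow L θ α ψ w
      check-arrow {θ} {α} {ψ} θ∈ α∈ ψ∈ elim intro =
        assuming (θ ∈? pos w) (λ i → assuming (α ∈? pos w) λ j →
          infer ψ∈ (⊢-trans (pair (⋀-lower i) (⋀-lower j)) elim))
        ⊗ witness
        where
        witness : Inconsistent w ⊎ (θ ∈ pos w ⊎ ∃ λ v → v ∈ L × w ⊑ v × α ∈ pos v × ψ ∈ neg v)
        witness with find-arrow-witness α∈ ψ∈
        ... | inj₁ v = inj₂ (inj₂ v)
        ... | inj₂ d = Sum.map₂ inj₁ (infer θ∈ (⊢-trans d intro))

      check-saturated : ∀ φ → (∀ {χ} → χ ∈ subformulas φ → χ ∈ Sf) →
                        Inconsistent w ⊎ Saturated L φ w
      check-subformulas : ∀ φ ψ {θ} → (∀ {χ} → χ ∈ θ ∷ subformulas φ ++ subformulas ψ → χ ∈ Sf) →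
                          Inconsistent w ⊎ (Saturated L φ w × Saturated L ψ w)

      check-saturated (var n) sub⊆ = inj₂ tt
      check-saturated ⊥' sub⊆ = assuming (⊥' ∈? pos w) λ i → inj₁ (⊢-trans (⋀-lower i) absurd)
      check-saturated (φ ∧' ψ) sub⊆ =
        (assuming (φ ∧' ψ ∈? pos w)
          (λ i → infer φ∈ (⊢-trans (⋀-lower i) fst) ⊗ infer ψ∈ (⊢-trans (⋀-lower i) snd))
         ⊗ assuming (φ ∈? pos w ×-dec ψ ∈? pos w)
          (λ (i , j) → infer (Sf∈Θ (sub⊆ (here refl))) (pair (⋀-lower i) (⋀-lower j))))
        ⊗ check-subformulas φ ψ sub⊆
        where
        φ∈ = Sf∈Θ (sub⊆ (there (here refl)))
        ψ∈ = Sf∈Θ (sub⊆ (there (∈-++⁺ʳ (subformulas φ) (here refl))))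
      check-saturated (φ ∨' ψ) sub⊆ =
        (assuming (φ ∨' ψ ∈? pos w) disjunct
         ⊗ assuming (φ ∈? pos w ⊎-dec ψ ∈? pos w)
          (λ { (inj₁ i) → infer φ∨ψ∈ (⊢-trans (⋀-lower i) inl)
             ; (inj₂ i) → infer φ∨ψ∈ (⊢-trans (⋀-lower i) inr) }))
        ⊗ check-subformulas φ ψ sub⊆
        where
        φ∨ψ∈ = Sf∈Θ (sub⊆ (here refl))
        disjunct : φ ∨' ψ ∈ pos w → Inconsistent w ⊎ (φ ∈ pos w ⊎ ψ ∈ pos w)
        disjunct i with pos⊎neg w (Sf∈Θ (sub⊆ (there (here refl))))
                      | pos⊎neg w (Sf∈Θ (sub⊆ (there (∈-++⁺ʳ (subformulas φ) (here refl)))))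
        ... | inj₁ j | _      = inj₂ (inj₁ j)
        ... | inj₂ _ | inj₁ k = inj₂ (inj₂ k)
        ... | inj₂ j | inj₂ k = inj₁ (⊢-trans (⋀-lower i) (cases (⋁-upper j) (⋁-upper k)))
      check-saturated (φ ⇒ ψ) sub⊆ =
        check-arrow (Sf∈Θ (sub⊆ (here refl))) (Sf∈Θ (sub⊆ (there (here refl))))
                    (Sf∈Θ (sub⊆ (there (∈-++⁺ʳ (subformulas φ) (here refl)))))
                    (uncurry ⊢-refl) ⊢-refl
        ⊗ check-subformulas φ ψ sub⊆
      check-saturated (φ ▷ ψ) sub⊆ =
        check-arrow (Sf∈Θ (sub⊆ (here refl))) (s∈Θ (sub⊆ (there (here refl))))
                    (Sf∈Θ ψ∈) (s-elim ψ∈) (s-intro {Sf})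
        ⊗ check-subformulas φ ψ sub⊆
        where
        ψ∈ = sub⊆ (there (∈-++⁺ʳ (subformulas φ) (here refl)))

      check-subformulas φ ψ sub⊆ =
        check-saturated φ (sub⊆ ∘ there ∘ ∈-++⁺ˡ)
        ⊗ check-saturated ψ (sub⊆ ∘ there ∘ ∈-++⁺ʳ (subformulas φ))

      check-disjoint : Inconsistent w ⊎ (∀ {χ} → χ ∈ pos w → χ ∈ neg w → ⊥)
      check-disjoint = search (pos w) λ {χ} i →
        assuming (χ ∈? neg w) λ j → inj₁ (⊢-trans (⋀-lower i) (⋁-upper j))

      -- Coextension in L is provable equivalence by `entails?`, so `s-cong` derives the second
      -- antecedent from the first; a failure puts that antecedent in the negative block and refutes
      -- w.
      check-congruent : Inconsistent w ⊎
        (∀ {φ} → φ ∈ Sf → ∀ {ψ} → ψ ∈ Sf →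
         Entails L φ ψ → Entails L ψ φ → s Sf φ ∈ pos w → s Sf ψ ∈ pos w)
      check-congruent = search Sf λ φ∈ → search Sf λ ψ∈ → congruence φ∈ ψ∈
        where
        congruence : ∀ {φ ψ} → φ ∈ Sf → ψ ∈ Sf →
          Inconsistent w ⊎ (Entails L φ ψ → Entails L ψ φ → s Sf φ ∈ pos w → s Sf ψ ∈ pos w)
        congruence {φ} φ∈ ψ∈ with entails? φ∈ | entails? ψ∈
        ... | inj₁ ¬e | _       = inj₂ λ e _ → ⊥-elim (¬e e)
        ... | inj₂ _  | inj₁ ¬e = inj₂ λ _ e → ⊥-elim (¬e e)
        ... | inj₂ d  | inj₂ e  = Sum.map₂ (λ f _ _ → f) (assuming (s Sf φ ∈? pos w)
                (λ i → infer (s∈Θ ψ∈) (⊢-trans (⋀-lower i) (s-cong {Sf} d e))))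

      check : Inconsistent w ⊎ Good L w
      check with check-disjoint | check-congruent | check-saturated φ₀ id
      ... | inj₁ i | _      | _      = inj₁ i
      ... | inj₂ _ | inj₁ i | _      = inj₁ i
      ... | inj₂ _ | inj₂ _ | inj₁ i = inj₁ i
      ... | inj₂ d | inj₂ c | inj₂ t =
        inj₂ record { disjoint = d ; congruent = c ; saturated = t }

  -- Being good depends on L, since a removal may destroy witnesses; so every removal restarts the
  -- search. The bound n on the length makes the recursion structural.
  stabilise : ∀ n (L : List (World Θ)) → length L ≤ n → Exhaustive L →
              ∃ λ L′ → Exhaustive L′ × (∀ {w} → w ∈ L′ → Good L′ w)
  stabilise n L len exh
    with search {A = ∃ λ w → w ∈ L × Inconsistent w} L
           (λ {w} w∈L → Sum.map₁ (λ i → w , w∈L , i) (check exh w))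
  ... | inj₂ good = L , exh , good
  ... | inj₁ (w , w∈L , i) with subst (_≤ n) (length-removeAt′ L (index w∈L)) len
  ...   | s≤s len′ = stabilise _ (L ─ w∈L) len′ exhaustive
    where
    exhaustive : Exhaustive (L ─ w∈L)
    exhaustive v with exh v
    ... | inj₁ j = inj₁ j
    ... | inj₂ v∈L with ∈-─ w∈L v∈L
    ...   | inj₁ refl = inj₁ i
    ...   | inj₂ j    = inj₂ j

  stable : ∃ λ L → Exhaustive L × (∀ {w} → w ∈ L → Good L w)
  stable = stabilise _ (worlds Θ) ≤-refl (inj₂ ∘ ∈-worlds)

-- The finite canonical model

module CanonicalModel {φ₀ : Fm} {L : List (World (Elimination.Θ φ₀))}
    (exh : Elimination.Exhaustive φ₀ L) (good : ∀ {w} → w ∈ L → Elimination.Good φ₀ L w) where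
  open Elimination φ₀

  Point : Set
  Point = Σ (World Θ) (_∈ L)

  infix 3 _⊩_
  _⊩_ : Point → Fm → Set
  x ⊩ χ = χ ∈ pos (proj₁ x)

  _≼_ : Point → Point → Set
  x ≼ y = proj₁ x ⊑ proj₁ y

  -- The upset S_a is the union of the extensions of s Sf φ over the φ in `Sf` whose extension is a;
  -- it is empty if there is no such φ.
  Rel : UpsetOf Point _≼_ → Point → Point → Set
  Rel a x y = x ≼ y × ∃ λ φ → φ ∈ Sf × (∀ z → (mem a z → z ⊩ φ) × (z ⊩ φ → mem a z)) × y ⊩ s Sf φ

  frame : Point → Frame lzero
  frame x₀ = record
    { X         = Point
    ; _≤_       = _≼_
    ; ≤-refl    = λ χ i → i
    ; ≤-trans   = λ x≼y y≼z χ → y≼z χ ∘ x≼y χ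
    ; point     = x₀
    ; R         = Rel
    ; R-ext     = λ a b a≡b (x≼y , φ , φ∈ , a≡φ , sφ) →
        x≼y , φ , φ∈ , (λ z → proj₁ (a≡φ z) ∘ proj₂ (a≡b z) , proj₁ (a≡b z) ∘ proj₂ (a≡φ z)) , sφ
    ; frameCond = λ a {x} {y} {z} x≼y (y≼z , h) → z , ((λ χ → y≼z χ ∘ x≼y χ) , h) , λ χ i → i
    }

  frame-inClass : ∀ x₀ → InClass (frame x₀)
  frame-inClass x₀ = record
    { R⊆≤  = λ a → proj₁
    -- The point y is its own successor: s Sf φ passes from u up to y.
    ; cond = λ a {x} {y} (u , (_ , φ , φ∈ , a≡φ , sφ) , u≼y) →
        y , ((λ χ i → i) , φ , φ∈ , a≡φ , u≼y _ sφ) , λ χ i → i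
    }

  valuation : ∀ x₀ → ℕ → Upset (frame x₀)
  valuation x₀ n = record { mem = _⊩ var n ; up = λ x≼y → x≼y (var n) }

  module _ (x₀ : Point) where
    open Sem (frame x₀) (valuation x₀)

    truth : ∀ φ → (∀ {χ} → χ ∈ subformulas φ → χ ∈ Sf) →
            (∀ {w} → w ∈ L → Saturated L φ w) → ∀ x → (x ⊨ φ → x ⊩ φ) × (x ⊩ φ → x ⊨ φ)
    truth (var n) sub⊆ sat x = id , id
    truth ⊥' sub⊆ sat x = (λ ()) , (λ i → lift (sat (proj₂ x) i))
    truth (φ ∧' ψ) sub⊆ sat x =
      (λ (h , k) → proj₂ here-x (proj₁ ihφ h , proj₁ ihψ k)) ,
      (λ i → Product.map (proj₂ ihφ) (proj₂ ihψ) (proj₁ here-x i))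
      where
      here-x = proj₁ (sat (proj₂ x))
      ihφ = truth φ (sub⊆ ∘ there ∘ ∈-++⁺ˡ) (proj₁ ∘ proj₂ ∘ sat) x
      ihψ = truth ψ (sub⊆ ∘ there ∘ ∈-++⁺ʳ (subformulas φ)) (proj₂ ∘ proj₂ ∘ sat) x
    truth (φ ∨' ψ) sub⊆ sat x =
      (λ h → proj₂ here-x (Sum.map (proj₁ ihφ) (proj₁ ihψ) h)) ,
      (λ i → Sum.map (proj₂ ihφ) (proj₂ ihψ) (proj₁ here-x i))
      where
      here-x = proj₁ (sat (proj₂ x))
      ihφ = truth φ (sub⊆ ∘ there ∘ ∈-++⁺ˡ) (proj₁ ∘ proj₂ ∘ sat) x
      ihψ = truth ψ (sub⊆ ∘ there ∘ ∈-++⁺ʳ (subformulas φ)) (proj₂ ∘ proj₂ ∘ sat) x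
    truth (φ ⇒ ψ) sub⊆ sat x = complete , λ i y x≼y h →
      proj₂ (ihψ y) (proj₁ (proj₁ (sat (proj₂ y))) (x≼y _ i) (proj₁ (ihφ y) h))
      where
      ihφ = truth φ (sub⊆ ∘ there ∘ ∈-++⁺ˡ) (proj₁ ∘ proj₂ ∘ sat)
      ihψ = truth ψ (sub⊆ ∘ there ∘ ∈-++⁺ʳ (subformulas φ)) (proj₂ ∘ proj₂ ∘ sat)
      complete : x ⊨ (φ ⇒ ψ) → x ⊩ φ ⇒ ψ
      complete h with proj₂ (proj₁ (sat (proj₂ x)))
      ... | inj₁ i = i
      ... | inj₂ (v , v∈L , x≼v , φ∈v , ψ∉v) = ⊥-elim
        (Good.disjoint (good v∈L) (proj₁ (ihψ y) (h y x≼v (proj₂ (ihφ y) φ∈v))) ψ∉v)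
        where y = v , v∈L
    -- The relation names the truth set of φ by some φ′, perhaps different from φ. By induction the
    -- two are coextensive on L, so `congruent` replaces s Sf φ′ by s Sf φ.
    truth (φ ▷ ψ) sub⊆ sat x = complete , λ i y (x≼y , φ′ , φ′∈ , φ≡φ′ , sφ′) →
      proj₂ (ihψ y) (proj₁ (proj₁ (sat (proj₂ y))) (x≼y _ i)
        (Good.congruent (good (proj₂ y)) φ′∈ φ∈
          (λ v∈L → proj₁ (ihφ (_ , v∈L)) ∘ proj₂ (φ≡φ′ (_ , v∈L)))
          (λ v∈L → proj₁ (φ≡φ′ (_ , v∈L)) ∘ proj₂ (ihφ (_ , v∈L)))
          sφ′))
      where
      φ∈ = sub⊆ (there (here refl))
      ihφ = truth φ (sub⊆ ∘ there ∘ ∈-++⁺ˡ) (proj₁ ∘ proj₂ ∘ sat)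
      ihψ = truth ψ (sub⊆ ∘ there ∘ ∈-++⁺ʳ (subformulas φ)) (proj₂ ∘ proj₂ ∘ sat)
      complete : x ⊨ (φ ▷ ψ) → x ⊩ φ ▷ ψ
      complete h with proj₂ (proj₁ (sat (proj₂ x)))
      ... | inj₁ i = i
      -- By the induction hypothesis φ itself names its truth set, so y is a successor of x, and ψ
      -- would lie in both blocks of v.
      ... | inj₂ (v , v∈L , x≼v , sφ∈v , ψ∉v) = ⊥-elim
        (Good.disjoint (good v∈L) (proj₁ (ihψ y) (h y (x≼v , φ , φ∈ , ihφ , sφ∈v))) ψ∉v)
        where y = v , v∈L

  -- Splitting on L provides the point that each frame needs: the model is formed only once some w
  -- in L is given, and an empty L yields the derivation at once.
  complete : Valid lzero φ₀ → sCondUC-ACL φ₀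
  complete valid = mp (split-on-L exh λ {w} w∈L →
    let x = w , w∈L
        x⊨φ₀ = valid (frame x) (frame-inClass x) (valuation x) x
    in ⊢-trans snd (⊢-trans (⋀-lower (proj₁ (truth x φ₀ id (Good.saturated ∘ good) x) x⊨φ₀)) inl))
    (⊢-refl {⊥'})

completeness : ∀ φ → Valid lzero φ → sCondUC-ACL φ
completeness φ valid with Elimination.stable φ
... | L , exh , good = CanonicalModel.complete exh good valid

theorem7p18 : (∀ (ℓ : Level) (φ : Fm) → sCondUC-ACL φ → Valid ℓ φ)
    ∧ω (∀ (φ : Fm) → (∀ (ℓ : Level) → Valid ℓ φ) → sCondUC-ACL φ)
theorem7p18 = (λ ℓ φ d F inClass → Soundness.sound inClass d)
    ,ω (λ φ valid → completeness φ (valid lzero))
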